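{- Let $AP$ be a finite non-empty set of atomic propositions, let $\pi$ be a normalized data stream over $AP$, let $\phi[\mathtt{var}]$ be a Finite LTL query over $AP$, and let $SC$ be the set of shattering intervals returned by the procedure $QC1(\pi,\phi[\mathtt{var}])$ described in the context. Then for any propositional formula $\gamma$ over $AP$, $\pi\models\phi[\gamma]$ if and only if there exists $[\gamma_1,\gamma_2]\in SC$ such that $\gamma_1\le\gamma\le\gamma_2$.
   Context: **Data streams.** A normalized data stream over $AP$ is a finite, possibly empty, sequence $\pi=A_0\ldots A_{n-1}$ with $A_i\subseteq AP$. Write $|\pi|=n$, $\pi_i=A_i$ for $i<n$, $\pi(i)=A_i\ldots A_{n-1}$ for $0\le i\le n$; $\varepsilon$ is the empty stream. **Finite LTL.** Formulas: $\phi::=a\mid\neg\phi\mid\phi_1\wedge\phi_2\mid\mathbf X\phi\mid\phi_1\mathbf U\phi_2$, $a\in AP$ (with $\vee,\mathit{true},\mathit{false}$ derived as usual). Semantics: $\pi\models a$ iff $|\pi|\ge1$ and $a\in\pi_0$; $\neg,\wedge$ as usual; $\pi\models\mathbf X\phi$ iff $|\pi|\ge1$ and $\pi(1)\models\phi$; $\pi\models\phi_1\mathbf U\phi_2$ iff there is $j$, $0\le j\le|\pi|$, with $\pi(j)\models\phi_2$ and $\pi(k)\models\phi_1$ for all $0\le k<j$. $\llbracket\phi\rrbracket=\{\pi\mid\pi\models\phi\}$; unsatisfiable means $\llbracket\phi\rrbracket=\emptyset$. $\phi_1\le\phi_2$ iff $\llbracket\phi_2\rrbracket\subseteq\llbracket\phi_1\rrbracket$.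 $\Gamma$ is the set of propositional formulas (those without $\mathbf X,\mathbf U$). $[\gamma_1,\gamma_2]=\{\gamma\in\Gamma\mid\gamma_1\le\gamma\le\gamma_2\}$. Let $[\mathit{true}]_{\sim_\varepsilon}=\{\gamma\in\Gamma\mid\varepsilon\models\gamma\}=[\mathit{true},\bigwedge_{a\in AP}\neg a]$ and $[\mathit{false}]_{\sim_\varepsilon}=\{\gamma\in\Gamma\mid\varepsilon\not\models\gamma\}=[\bigvee_{a\in AP}a,\mathit{false}]$. **Queries.** A Finite LTL query $\phi[\mathtt{var}]$ is built by the same grammar with an additional leaf $\mathtt{var}$; $\phi[\gamma]$ replaces all occurrences of $\mathtt{var}$ by $\gamma\in\Gamma$. $\Gamma[\mathtt{var}]$ is the set of propositional queries (no modalities). $\gamma'\in\Gamma$ shatters $\gamma[\mathtt{var}]\in\Gamma[\mathtt{var}]$ iff $\gamma[\gamma']$ is unsatisfiable. The shattering interval $I_{\gamma[\mathtt{var}]}$ is the set of all $\gamma'\in\Gamma$ shattering $\gamma[\mathtt{var}]$; it is either empty or a propositional interval. For a finite set of intervals, $\bigwedge_i[\gamma_i',\gamma_i'']=[\bigwedge_i\gamma_i',\bigvee_i\gamma_i'']$, which as a set equals the intersection; for the empty set of intervals it is $[\mathit{true},\mathit{false}]=\Gamma$. **PNFA.** A propositional NFA is $(Q,AP,q_I,\delta,F)$ with $Q$ a finite set, $q_I\in Q$, $F\subseteq Q$, $\delta\subseteq Q\times\Gamma\times Q$. State $q$ accepts $w\in(2^{AP})^*$ iff $w=\varepsilon$ and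 $q\in F$, or $w=Aw'$ with $A\subseteq AP$ and there is $(q,\gamma,q')\in\delta$ with $A\models\gamma$ ($A$ viewed as a length-one stream) and $q'$ accepts $w'$. $L(M)$ is the set of $w$ accepted by $q_I$. **FQA.** A Finite Query Automaton is $M[\mathtt{var}]=(Q,AP,q_I,\delta[\mathtt{var}],F[\mathtt{var}])$ with $Q$ a finite set, $q_I\in Q$, $\delta[\mathtt{var}]\subseteq Q\times\Gamma[\mathtt{var}]\times Q$ finite, $F[\mathtt{var}]:Q\to\Gamma[\mathtt{var}]$. For $\gamma\in\Gamma$, $M[\gamma]$ is the PNFA $(Q,AP,q_I,\delta[\gamma],F[\gamma])$ with $\delta[\gamma]=\{(q,\gamma'[\gamma],q')\mid(q,\gamma'[\mathtt{var}],q')\in\delta[\mathtt{var}]\}$, $F[\gamma]=\{q\mid\varepsilon\models(F[\mathtt{var}](q))[\gamma]\}$. **Composition.** For a PNFA $M_1=(Q_1,AP,q_1,\delta_1,F_1)$ and an FQA $M_2[\mathtt{var}]=(Q_2,AP,q_2,\delta_2[\mathtt{var}],F_2[\mathtt{var}])$, $(M_1\otimes M_2)[\mathtt{var}]$ is the FQA with states $Q_1\times Q_2$, initial state $(q_1,q_2)$, transitions $((q_1',q_2'),\gamma_1\wedge\gamma_2[\mathtt{var}],(q_1'',q_2''))$ for all $(q_1',\gamma_1,q_1'')\in\delta_1$ and $(q_2',\gamma_2[\mathtt{var}],q_2'')\in\delta_2[\mathtt{var}]$, and acceptance condition mapping $(q_1',q_2')$ to $F_2[\mathtt{var}](q_2')$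 if $q_1'\in F_1$ and to $\mathit{false}$ otherwise (so that its instantiation by $\gamma$ has accepting set $F_1\times F_2[\gamma]$). **Procedure $\mathit{ShatterFQA}(M[\mathtt{var}])$.** Preprocessing: let $TL$ be the set of labels of transitions in $\delta[\mathtt{var}]$; $UL=\{\gamma[\mathtt{var}]\in TL\mid I_{\gamma[\mathtt{var}]}=\emptyset\}$; $DL=\{\gamma[\mathtt{var}]\in TL\mid I_{\gamma[\mathtt{var}]}=[\mathit{true},\mathit{false}]\}$; $SL=TL\setminus(UL\cup DL)$; $\delta'[\mathtt{var}]=\{(q,\gamma[\mathtt{var}],q')\in\delta[\mathtt{var}]\mid\gamma[\mathtt{var}]\in SL\}\cup\{(q,\mathit{true},q')\mid\exists\gamma[\mathtt{var}]\in UL,\ (q,\gamma[\mathtt{var}],q')\in\delta[\mathtt{var}]\}$. Main: start with $SC=\emptyset$. For each $S\subseteq SL$: let $I_S=\bigwedge\{I_{\gamma[\mathtt{var}]}\mid\gamma[\mathtt{var}]\in S\}$, $PSC=\emptyset$, $\delta''=\{(q,\mathit{true},q')\mid(q,\gamma[\mathtt{var}],q')\in\delta'[\mathtt{var}],\ \gamma[\mathtt{var}]\notin S\}$. If $I_S\cap[\mathit{true}]_{\sim_\varepsilon}\ne\emptyset$ and $L(Q,AP,q_I,\delta'',F[\mathit{true}])=\emptyset$, add $I_S\cap[\mathit{true}]_{\sim_\varepsilon}$ to $PSC$. If $I_S\cap[\mathit{false}]_{\sim_\varepsilon}\ne\emptyset$ and $L(Q,AP,q_I,\delta'',F[\mathit{false}])=\emptyset$,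 add $I_S\cap[\mathit{false}]_{\sim_\varepsilon}$ to $PSC$. If $|PSC|=2$, add $I_S$ to $SC$; otherwise add all elements of $PSC$ to $SC$. Finally return $SC$. **Procedure $QC1(\pi,\phi[\mathtt{var}])$**, with $\pi=A_0\ldots A_{n-1}$. (1) Form the PNFA $M_\pi=(\{q_0,\ldots,q_n\},AP,q_0,\delta_\pi,\{q_n\})$ with $\delta_\pi=\{(q_i,\langle A_i\rangle,q_{i+1})\mid0\le i<n\}$, where for $A\subseteq AP$, $\langle A\rangle=\bigwedge\{a\mid a\in A\}\wedge\bigwedge\{\neg b\mid b\in AP,b\notin A\}$. (2) Form an FQA $M_{\neg\phi}[\mathtt{var}]$ for the query $\neg\phi[\mathtt{var}]$, i.e. one with $L(M_{\neg\phi}[\gamma])=\llbracket\neg(\phi[\gamma])\rrbracket$ for every $\gamma\in\Gamma$. (3) Form $M_c[\mathtt{var}]=(M_\pi\otimes M_{\neg\phi})[\mathtt{var}]$. (4) Return $SC=\mathit{ShatterFQA}(M_c[\mathtt{var}])$. -}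

module Defs where

open import Level using (0ℓ; _⊔_) renaming (suc to lsuc)
open import Data.Bool.Base using (if_then_else_)
open import Data.Empty using (⊥)
open import Data.Fin.Base using (Fin; zero; suc; inject₁; fromℕ)
open import Data.Fin.Properties using (*↔×) renaming (_≟_ to _≟ᶠ_)
open import Data.Fin.Subset using (Subset) renaming (_∈_ to _∈ˢ_)
open import Data.Fin.Subset.Properties using () renaming (_∈?_ to _∈ˢ?_)
open import Data.List.Base
  using (List; []; _∷_; length; lookup; drop; map; foldr; filter; allFin; cartesianProductWith)
open import Data.List.Membership.Propositional using () renaming (_∈_ to _∈ˡ_; _∉_ to _∉ˡ_)
open import Data.List.Relation.Unary.All using (All)
open import Data.Nat.Base using (ℕ; suc; _*_; _≤_; _<_)
open import Data.Product.Base using (∃-syntax; ∃₂; _×_; _,_)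
open import Data.Product.Function.NonDependent.Propositional using (_×-↔_)
open import Data.Sum.Base using (_⊎_)
open import Function.Base using (id)
open import Function.Bundles using (_↔_; _⇔_; mk⇔)
open import Function.Properties.Inverse using (↔-refl; ↔-sym; ↔-trans)
open import Relation.Binary.PropositionalEquality.Core using (_≡_)
open import Relation.Nullary.Decidable using (does; ¬?)
open import Relation.Nullary.Negation using (¬_)
open import Relation.Unary
  using (Pred; Decidable; _∈_; _⊆_; _≐_; _∩_; _∪_; _∖_; Empty; Satisfiable)

-- The finite non-empty set of atomic propositions is Fin (suc n).
AP : ℕ → Set
AP n = Fin (suc n)

Letter : ℕ → Set
Letter n = Subset (suc n)

Stream : ℕ → Set
Stream n = List (Letter n)

data Modality : Set where
  propositional temporal : Modality

data Kind : Set where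
  formula query : Kind

infix  8 ¬ᶠ_ X_
infixr 7 _∧ᶠ_ _∨ᶠ_
infixr 6 _U_

-- Formulas and queries share one grammar; the indices restrict the leaf var
-- to queries and the operators X and U to temporal formulas and queries.
data Fml (n : ℕ) : Modality → Kind → Set where
  atom : ∀ {m k} → AP n → Fml n m k
  var  : ∀ {m} → Fml n m query
  ¬ᶠ_  : ∀ {m k} → Fml n m k → Fml n m k
  _∧ᶠ_ : ∀ {m k} → Fml n m k → Fml n m k → Fml n m k
  X_   : ∀ {k} → Fml n temporal k → Fml n temporal k
  _U_  : ∀ {k} → Fml n temporal k → Fml n temporal k → Fml n temporal k

LTL Γ Query Γ[var] : ℕ → Set
LTL    n = Fml n temporal      formula
Γ      n = Fml n propositional formula
Query  n = Fml n temporal      query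
Γ[var] n = Fml n propositional query

private
  variable
    n : ℕ
    m : Modality
    k : Kind

_∨ᶠ_ : Fml n m k → Fml n m k → Fml n m k
φ ∨ᶠ ψ = ¬ᶠ (¬ᶠ φ ∧ᶠ ¬ᶠ ψ)

trueᶠ falseᶠ : Fml n m k
trueᶠ  = atom zero ∨ᶠ ¬ᶠ atom zero
falseᶠ = ¬ᶠ trueᶠ

⋀ᶠ : List (Fml n m k) → Fml n m k
⋀ᶠ = foldr _∧ᶠ_ trueᶠ

-- The inclusion of Γ into each of the four classes.
embed : Γ n → Fml n m k
embed (atom a)   = atom a
embed (¬ᶠ γ)     = ¬ᶠ embed γ
embed (γ₁ ∧ᶠ γ₂) = embed γ₁ ∧ᶠ embed γ₂

infix 9 _[_]

_[_] : Fml n m query → Γ n → Fml n m formula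
atom a     [ γ ] = atom a
var        [ γ ] = embed γ
(¬ᶠ φ)     [ γ ] = ¬ᶠ (φ [ γ ])
(φ ∧ᶠ ψ)   [ γ ] = (φ [ γ ]) ∧ᶠ (ψ [ γ ])
(X φ)      [ γ ] = X (φ [ γ ])
(φ U ψ)    [ γ ] = (φ [ γ ]) U (ψ [ γ ])

HeadHas : Stream n → AP n → Set
HeadHas []      a = ⊥
HeadHas (A ∷ _) a = a ∈ˢ A

infix 4 _⊨_ _≤ᶠ_

_⊨_ : Stream n → Fml n m formula → Set
π ⊨ atom a   = HeadHas π a
π ⊨ ¬ᶠ φ     = ¬ (π ⊨ φ)
π ⊨ φ ∧ᶠ ψ   = (π ⊨ φ) × (π ⊨ ψ)
π ⊨ X φ      = (1 ≤ length π) × (drop 1 π ⊨ φ)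
π ⊨ φ U ψ    = ∃[ j ] (j ≤ length π) × (drop j π ⊨ ψ) × (∀ i → i < j → drop i π ⊨ φ)

⟦_⟧ : Fml n m formula → Pred (Stream n) 0ℓ
⟦ φ ⟧ π = π ⊨ φ

Unsatisfiable : Fml n m formula → Set
Unsatisfiable φ = Empty ⟦ φ ⟧

-- The order is reversed with respect to entailment: true is least.
_≤ᶠ_ : Fml n m formula → Fml n m formula → Set
φ₁ ≤ᶠ φ₂ = ⟦ φ₂ ⟧ ⊆ ⟦ φ₁ ⟧

FmlSet : ℕ → Set₁
FmlSet n = Pred (Γ n) 0ℓ

[_⋯_] : Γ n → Γ n → FmlSet n
[ γ₁ ⋯ γ₂ ] γ = (γ₁ ≤ᶠ γ) × (γ ≤ᶠ γ₂)

[true]∼ε [false]∼ε : FmlSet n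
[true]∼ε  γ = [] ⊨ γ
[false]∼ε γ = ¬ ([] ⊨ γ)

Shatters : Γ n → Γ[var] n → Set
Shatters γ′ γ = Unsatisfiable (γ [ γ′ ])

𝐈 : Γ[var] n → FmlSet n
𝐈 γ γ′ = Shatters γ′ γ

-- The intersection over the empty list is all of Γ.
⋀𝐈 : List (Γ[var] n) → FmlSet n
⋀𝐈 S γ′ = All (λ γ → γ′ ∈ 𝐈 γ) S

IsFinite : Set → Set
IsFinite Q = ∃[ s ] (Q ↔ Fin s)

×-finite : ∀ {Q₁ Q₂} → IsFinite Q₁ → IsFinite Q₂ → IsFinite (Q₁ × Q₂)
×-finite (s₁ , f₁) (s₂ , f₂) = s₁ * s₂ , ↔-trans (f₁ ×-↔ f₂) (↔-sym *↔×)

record PNFA (n : ℕ) : Set₁ where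
  field
    Q      : Set
    finite : IsFinite Q
    qI     : Q
    δ      : Pred (Q × Γ n × Q) 0ℓ
    F      : Pred Q 0ℓ

data Accepts (M : PNFA n) : PNFA.Q M → Stream n → Set where
  done : ∀ {q} → q ∈ PNFA.F M → Accepts M q []
  step : ∀ {q γ q′ A w} → (q , γ , q′) ∈ PNFA.δ M → (A ∷ []) ⊨ γ →
         Accepts M q′ w → Accepts M q (A ∷ w)

L : PNFA n → Pred (Stream n) 0ℓ
L M = Accepts M (PNFA.qI M)

record FQA (n : ℕ) : Set₁ where
  field
    Q      : Set
    finite : IsFinite Q
    qI     : Q
    δ      : List (Q × Γ[var] n × Q)
    F      : Q → Γ[var] n

  -- F[γ]
  accepting : Γ n → Pred Q 0ℓ
  accepting γ q = [] ⊨ F q [ γ ]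

instantiate : FQA n → Γ n → PNFA n
instantiate M γ = record
  { Q      = Q
  ; finite = finite
  ; qI     = qI
  ; δ      = λ (q , γ₁ , q′) → ∃[ γ′ ] ((q , γ′ , q′) ∈ˡ δ) × (γ₁ ≡ γ′ [ γ ])
  ; F      = accepting γ
  }
  where open FQA M

-- What the composition needs of its first argument to produce an FQA, whose
-- transitions are a finite list and whose acceptance condition is a function.
record Effective (M : PNFA n) : Set where
  open PNFA M
  field
    transitions : List (Q × Γ n × Q)
    enumerates  : ∀ t → (t ∈ δ) ⇔ (t ∈ˡ transitions)
    F?          : Decidable F

compose : (M₁ : PNFA n) → Effective M₁ → FQA n → FQA n
compose M₁ eff M₂ = record
  { Q      = M₁.Q × M₂.Q
  ; finite = ×-finite M₁.finite M₂.finite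
  ; qI     = M₁.qI , M₂.qI
  ; δ      = cartesianProductWith
               (λ (q₁ , γ₁ , q₁′) (q₂ , γ₂ , q₂′) → (q₁ , q₂) , (embed γ₁ ∧ᶠ γ₂) , (q₁′ , q₂′))
               transitions M₂.δ
  ; F      = λ (q₁ , q₂) → if does (F? q₁) then M₂.F q₂ else falseᶠ
  }
  where
    module M₁ = PNFA M₁
    module M₂ = FQA M₂
    open Effective eff

-- A set of sets of formulas. Those built below are closed under extensional
-- equality _≐_, so that an interval may be given by any pair of endpoints.
Family : ℕ → Set₂
Family n = Pred (FmlSet n) (lsuc 0ℓ)

HasTwoElements : ∀ {ℓ} → Pred (FmlSet n) ℓ → Set (lsuc 0ℓ ⊔ ℓ)
HasTwoElements P = ∃₂ λ J K →
  J ∈ P × K ∈ P × ¬ (J ≐ K) × (∀ H → H ∈ P → (H ≐ J) ⊎ (H ≐ K))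

module Shatter (M : FQA n) where
  open FQA M

  TL UL DL SL : Pred (Γ[var] n) 0ℓ
  TL = λ γ → ∃₂ λ q q′ → (q , γ , q′) ∈ˡ δ
  UL = TL ∩ λ γ → Empty (𝐈 γ)
  DL = TL ∩ λ γ → 𝐈 γ ≐ [ trueᶠ ⋯ falseᶠ ]
  SL = TL ∖ (UL ∪ DL)

  δ′ : Pred (Q × Γ[var] n × Q) 0ℓ
  δ′ = (λ (q , γ , q′) → ((q , γ , q′) ∈ˡ δ) × γ ∈ SL)
     ∪ (λ (q , γ , q′) → (γ ≡ trueᶠ) × ∃[ γ₁ ] (γ₁ ∈ UL) × ((q , γ₁ , q′) ∈ˡ δ))

  module _ (S : List (Γ[var] n)) where
    δ″ : Pred (Q × Γ n × Q) 0ℓ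
    δ″ (q , γ , q′) = (γ ≡ trueᶠ) × ∃[ γ₁ ] ((q , γ₁ , q′) ∈ δ′) × (γ₁ ∉ˡ S)

    approx : Γ n → PNFA n
    approx γ = record { Q = Q ; finite = finite ; qI = qI ; δ = δ″ ; F = accepting γ }

    data PSC (J : FmlSet n) : Set where
      add-true  : Satisfiable (⋀𝐈 S ∩ [true]∼ε) → Empty (L (approx trueᶠ)) →
                  J ≐ (⋀𝐈 S ∩ [true]∼ε) → PSC J
      add-false : Satisfiable (⋀𝐈 S ∩ [false]∼ε) → Empty (L (approx falseᶠ)) →
                  J ≐ (⋀𝐈 S ∩ [false]∼ε) → PSC J

  -- A subset of SL is presented by a list of its elements.
  data SC (J : FmlSet n) : Set₁ where
    add-whole : ∀ S → All SL S → HasTwoElements (PSC S) → J ≐ ⋀𝐈 S → SC J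
    add-parts : ∀ S → All SL S → ¬ HasTwoElements (PSC S) → J ∈ PSC S → SC J

ShatterFQA : FQA n → Family n
ShatterFQA M = Shatter.SC M

⟨_⟩ : Letter n → Γ n
⟨ A ⟩ = ⋀ᶠ (map atom (filter (_∈ˢ? A) (allFin _)))
     ∧ᶠ ⋀ᶠ (map (λ b → ¬ᶠ atom b) (filter (λ b → ¬? (b ∈ˢ? A)) (allFin _)))

pathTransitions : (π : Stream n) → List (Fin (suc (length π)) × Γ n × Fin (suc (length π)))
pathTransitions π = map (λ i → inject₁ i , ⟨ lookup π i ⟩ , suc i) (allFin (length π))

pathPNFA : Stream n → PNFA n
pathPNFA π = record
  { Q      = Fin (suc (length π))
  ; finite = suc (length π) , ↔-refl
  ; qI     = zero
  ; δ      = _∈ˡ pathTransitions π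
  ; F      = _≡ fromℕ (length π)
  }

pathPNFA-effective : (π : Stream n) → Effective (pathPNFA π)
pathPNFA-effective π = record
  { transitions = pathTransitions π
  ; enumerates  = λ _ → mk⇔ id id
  ; F?          = _≟ᶠ fromℕ (length π)
  }

record FQAFor (ψ : Query n) : Set₁ where
  field
    automaton : FQA n
    correct   : ∀ γ → L (instantiate automaton γ) ≐ ⟦ ψ [ γ ] ⟧

-- Any automaton for the negated query may be chosen in the second step.
QC1 : Stream n → (φ : Query n) → FQAFor (¬ᶠ φ) → Family n
QC1 π φ M¬φ =
  ShatterFQA (compose (pathPNFA π) (pathPNFA-effective π) (FQAFor.automaton M¬φ))

{-# OPTIONS --safe #-}
-- The shattering interval of γ[var] is [ ¬ γ[true] , γ[false] ], so every set
-- handled by ShatterFQA is an interval. If γ lies in I_S, the surviving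
-- transitions of δ″ include those whose label γ does not shatter, and when S
-- consists of all labels in SL shattered by γ they are exactly those. A label
-- ⟨ A ⟩ ∧ γ₂[γ] of the composition is satisfiable only by A, so an accepting run
-- over unshattered transitions is an accepting run of M¬φ[γ] on π. Hence
-- π ⊨ φ[γ] iff no such run exists. Moreover all these runs have length |π|, which
-- makes the emptiness tests of the procedure decidable.
module Submission where

open import Defs
open import Level using (0ℓ)
open import Data.Bool.Base using (Bool; true; false; not; if_then_else_)
open import Data.Fin.Base using (Fin; zero; suc; toℕ; inject₁; fromℕ)
open import Data.Fin.Properties using (toℕ-fromℕ; inj⇒≟) renaming (_≟_ to _≟ᶠ_)
open import Data.Fin.Relation.Unary.Top using (view; ‵fromℕ; ‵inject₁)
open import Data.Fin.Subset using (⊥)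
open import Data.Fin.Subset.Properties using (∉⊥; anySubset?) renaming (_∈?_ to _∈ˢ?_)
open import Data.List.Base using (List; []; _∷_; length; lookup; drop; map; filter; replicate; allFin)
open import Data.List.Membership.Propositional using (find; lose) renaming (_∈_ to _∈ˡ_; _∉_ to _∉ˡ_)
open import Data.List.Membership.Propositional.Properties
  using (∈-allFin; ∈-filter⁺; ∈-filter⁻; ∈-map⁺; ∈-map⁻; ∈-cartesianProductWith⁺; ∈-cartesianProductWith⁻)
open import Data.List.Properties using (drop-all)
open import Data.List.Relation.Unary.All as All using (All; []; _∷_)
open import Data.List.Relation.Unary.Any as Any using (Any)
open import Data.Nat.Base using (ℕ; zero; suc; s≤s; s≤s⁻¹)
open import Data.Nat.Properties using (_≤?_; anyUpTo?; allUpTo?; ≤-reflexive)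
open import Data.Product.Base using (∃-syntax; ∃₂; _×_; _,_; proj₁; proj₂)
open import Data.Product.Function.NonDependent.Propositional using (_×-⇔_)
open import Data.Sum.Base using (_⊎_; inj₁; inj₂)
open import Function.Base using (id; const; _∘_)
open import Function.Bundles using (_⇔_; mk⇔; Equivalence)
open import Function.Construct.Composition using (_⇔-∘_)
open import Function.Construct.Symmetry using (⇔-sym)
open import Function.Construct.Identity using (⇔-id)
open import Function.Properties.Inverse using (↔⇒↣)
open import Function.Related.TypeIsomorphisms using (¬-cong-⇔)
open import Relation.Binary.Definitions using (DecidableEquality)
open import Relation.Binary.PropositionalEquality
  using (_≡_; refl; sym; trans; cong; subst)
open import Relation.Nullary.Decidable
  using (Dec; yes; no; does; map′; ¬?; _×-dec_; decidable-stable; dec-true)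
open import Relation.Nullary.Negation using (¬_; contradiction)
open import Relation.Unary using (Pred; Decidable; _∈_; _≐_; _∩_; Empty; Satisfiable)
open import Relation.Unary.Properties using (≐-refl; ≐-sym; ≐-trans)

open Equivalence using (to; from)

private
  variable
    n : ℕ
    m : Modality
    k : Kind

-- Semantics

_⊨?_ : (σ : Stream n) (φ : Fml n m formula) → Dec (σ ⊨ φ)
[]      ⊨? atom a = no λ ()
(A ∷ _) ⊨? atom a = a ∈ˢ? A
σ ⊨? (¬ᶠ φ)   = ¬? (σ ⊨? φ)
σ ⊨? (φ ∧ᶠ ψ) = (σ ⊨? φ) ×-dec (σ ⊨? ψ)
σ ⊨? (X φ)    = (1 ≤? length σ) ×-dec (drop 1 σ ⊨? φ)
σ ⊨? (φ U ψ)  =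
  map′ (λ (j , j< , r , h) → j , s≤s⁻¹ j< , r , λ i i<j → h i<j)
       (λ (j , j≤ , r , h) → j , s≤s j≤ , r , λ {i} i<j → h i i<j)
       (anyUpTo? (λ j → (drop j σ ⊨? ψ) ×-dec allUpTo? (λ i → drop i σ ⊨? φ) j)
                 (suc (length σ)))

infix 4 _≈_

_≈_ : Stream n → Stream n → Set
σ ≈ τ = ∀ a → HeadHas σ a ⇔ HeadHas τ a

⊨-cong : ∀ {σ τ : Stream n} → σ ≈ τ → (g : Γ n) → (σ ⊨ g) ⇔ (τ ⊨ g)
⊨-cong σ≈τ (atom a) = σ≈τ a
⊨-cong σ≈τ (¬ᶠ g)   = ¬-cong-⇔ (⊨-cong σ≈τ g)
⊨-cong σ≈τ (g ∧ᶠ h) = ⊨-cong σ≈τ g ×-⇔ ⊨-cong σ≈τ h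

-- The empty stream satisfies no atom, exactly like the empty letter. Hence propositional
-- satisfiability is a search over the finitely many letters.
letter : Stream n → Letter n
letter []      = ⊥
letter (A ∷ _) = A

≈-letter : (σ : Stream n) → σ ≈ letter σ ∷ []
≈-letter []      a = mk⇔ (λ ()) ∉⊥
≈-letter (A ∷ _) a = ⇔-id _

satisfiable? : (g : Γ n) → Dec (Satisfiable ⟦ g ⟧)
satisfiable? g =
  map′ (λ (A , A⊨g) → A ∷ [] , A⊨g)
       (λ (σ , σ⊨g) → letter σ , to (⊨-cong (≈-letter σ) g) σ⊨g)
       (anySubset? (λ A → (A ∷ []) ⊨? g))

unsatisfiable? : (g : Γ n) → Dec (Unsatisfiable g)
unsatisfiable? g = map′ (λ ¬s σ σ⊨g → ¬s (σ , σ⊨g)) (λ e (σ , σ⊨g) → e σ σ⊨g) (¬? (satisfiable? g))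

≤ᶠ? : (g h : Γ n) → Dec (g ≤ᶠ h)
≤ᶠ? g h =
  map′ (λ e {σ} σ⊨h → decidable-stable (σ ⊨? g) λ σ⊭g → e σ (σ⊨h , σ⊭g))
       (λ g≤h σ (σ⊨h , σ⊭g) → σ⊭g (g≤h σ⊨h))
       (unsatisfiable? (h ∧ᶠ ¬ᶠ g))

⊨-true : (σ : Stream n) → σ ⊨ trueᶠ {m = propositional}
⊨-true σ (¬a , ¬¬a) = ¬¬a ¬a

constant : Bool → Γ n
constant b = if b then trueᶠ else falseᶠ

⊨-constant : (σ : Stream n) (g : Γ n) → (σ ⊨ g) ⇔ (σ ⊨ constant (does (σ ⊨? g)))
⊨-constant σ g with σ ⊨? g
... | yes σ⊨g = mk⇔ (const (⊨-true σ)) (const σ⊨g)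
... | no  σ⊭g = mk⇔ (λ σ⊨g → contradiction σ⊨g σ⊭g) (λ σ⊨f → contradiction (⊨-true σ) σ⊨f)

⊨-embed : (σ : Stream n) (g : Γ n) → (σ ⊨ embed {m = m} g) ⇔ (σ ⊨ g)
⊨-embed σ (atom a) = ⇔-id _
⊨-embed σ (¬ᶠ g)   = ¬-cong-⇔ (⊨-embed σ g)
⊨-embed σ (g ∧ᶠ h) = ⊨-embed σ g ×-⇔ ⊨-embed σ h

⊨-embed-[] : (σ : Stream n) (g h : Γ n) → (σ ⊨ embed {m = m} g [ h ]) ⇔ (σ ⊨ g)
⊨-embed-[] σ (atom a)  h = ⇔-id _
⊨-embed-[] σ (¬ᶠ g)    h = ¬-cong-⇔ (⊨-embed-[] σ g h)
⊨-embed-[] σ (g ∧ᶠ g′) h = ⊨-embed-[] σ g h ×-⇔ ⊨-embed-[] σ g′ h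

-- Without modalities, evaluation never leaves `σ`, so only the truth value at `σ` of the
-- substituted formula matters.
⊨-[]-cong : (σ : Stream n) {g h : Γ n} → (σ ⊨ g) ⇔ (σ ⊨ h) →
            (l : Γ[var] n) → (σ ⊨ l [ g ]) ⇔ (σ ⊨ l [ h ])
⊨-[]-cong σ g⇔h (atom a)  = ⇔-id _
⊨-[]-cong σ {g} {h} g⇔h var = ⇔-sym (⊨-embed σ h) ⇔-∘ (g⇔h ⇔-∘ ⊨-embed σ g)
⊨-[]-cong σ g⇔h (¬ᶠ l)    = ¬-cong-⇔ (⊨-[]-cong σ g⇔h l)
⊨-[]-cong σ g⇔h (l ∧ᶠ l′) = ⊨-[]-cong σ g⇔h l ×-⇔ ⊨-[]-cong σ g⇔h l′

⊨-⋀-filter : {B : Set} {P : Pred B 0ℓ} (P? : Decidable P) (f : B → Γ n) (σ : Stream n) (xs : List B) →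
             (σ ⊨ ⋀ᶠ (map f (filter P? xs))) ⇔ All (λ x → P x → σ ⊨ f x) xs
⊨-⋀-filter P? f σ [] = mk⇔ (const []) (const (⊨-true σ))
⊨-⋀-filter P? f σ (x ∷ xs) with P? x
... | yes px = mk⇔ (λ (s , ss) → const s ∷ to rec ss) (λ { (s ∷ ss) → s px , from rec ss })
  where rec = ⊨-⋀-filter P? f σ xs
... | no ¬px = mk⇔ (λ ss → (λ px → contradiction px ¬px) ∷ to rec ss) (λ { (_ ∷ ss) → from rec ss })
  where rec = ⊨-⋀-filter P? f σ xs

-- Only `≈` and not equality: tails are invisible, and for `A` empty the empty stream qualifies too.
⊨-⟨⟩ : (σ : Stream n) (A : Letter n) → (σ ⊨ ⟨ A ⟩) ⇔ (σ ≈ A ∷ [])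
⊨-⟨⟩ σ A = mk⇔
  (λ (pos , neg) a → mk⇔
    (λ σa → decidable-stable (a ∈ˢ? A) λ a∉A → All.lookup (to outside neg) (∈-allFin a) a∉A σa)
    (λ a∈A → All.lookup (to inside pos) (∈-allFin a) a∈A))
  (λ σ≈A → from inside (All.universal (λ a → from (σ≈A a)) _)
         , from outside (All.universal (λ a a∉A σa → a∉A (to (σ≈A a) σa)) _))
  where
    inside  = ⊨-⋀-filter (_∈ˢ? A) atom σ (allFin _)
    outside = ⊨-⋀-filter (λ b → ¬? (b ∈ˢ? A)) (λ b → ¬ᶠ atom b) σ (allFin _)

-- Intervals

IsInterval : FmlSet n → Set
IsInterval J = ∃₂ λ γ₁ γ₂ → J ≐ [ γ₁ ⋯ γ₂ ]

∩-interval : {J K : FmlSet n} → IsInterval J → IsInterval K → IsInterval (J ∩ K)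
∩-interval (g₁ , g₂ , J⊆ , ⊆J) (h₁ , h₂ , K⊆ , ⊆K) = g₁ ∧ᶠ h₁ , g₂ ∨ᶠ h₂ ,
  (λ {γ} (j , k) →
    (λ s → proj₁ (J⊆ j) s , proj₁ (K⊆ k) s) ,
    -- `∨ᶠ` is a negated conjunction, so its disjuncts are reached only under double negation.
    (λ {σ} s → decidable-stable (σ ⊨? γ) λ ¬γ →
       s ((λ t → ¬γ (proj₂ (J⊆ j) t)) , (λ t → ¬γ (proj₂ (K⊆ k) t))))) ,
  (λ (lo , hi) →
    ⊆J ((λ s → proj₁ (lo s)) , (λ s → hi λ (¬g , _) → ¬g s)) ,
    ⊆K ((λ s → proj₂ (lo s)) , (λ s → hi λ (_ , ¬h) → ¬h s)))

-- By transitivity of the order, an interval is inhabited exactly when it contains its lower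
-- endpoint.
interval-satisfiable? : {J : FmlSet n} → IsInterval J → Dec (Satisfiable J)
interval-satisfiable? (g₁ , g₂ , J⊆ , ⊆J) with ≤ᶠ? g₁ g₂
... | yes g₁≤g₂ = yes (g₁ , ⊆J (id , g₁≤g₂))
... | no  g₁≰g₂ = no λ (γ , γ∈J) → g₁≰g₂ λ s → proj₁ (J⊆ γ∈J) (proj₂ (J⊆ γ∈J) s)

full : (γ : Γ n) → γ ∈ [ trueᶠ ⋯ falseᶠ ]
full γ = (λ {σ} _ → ⊨-true σ) , (λ {σ} s → contradiction (⊨-true σ) s)

⊨-as-true : (σ : Stream n) (γ : Γ n) → σ ⊨ γ → (l : Γ[var] n) → (σ ⊨ l [ γ ]) ⇔ (σ ⊨ l [ trueᶠ ])
⊨-as-true σ γ s l = ⊨-[]-cong σ (mk⇔ (const (⊨-true σ)) (const s)) l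

⊨-as-false : (σ : Stream n) (γ : Γ n) → ¬ (σ ⊨ γ) → (l : Γ[var] n) → (σ ⊨ l [ γ ]) ⇔ (σ ⊨ l [ falseᶠ ])
⊨-as-false σ γ ¬s l = ⊨-[]-cong σ (mk⇔ (λ s → contradiction s ¬s) (λ f → contradiction (⊨-true σ) f)) l

shatters-constants : (l : Γ[var] n) → Shatters trueᶠ l → Shatters falseᶠ l → (γ : Γ n) → Shatters γ l
shatters-constants l t f γ σ s with σ ⊨? γ
... | yes g = t σ (to (⊨-as-true σ γ g l) s)
... | no ¬g = f σ (to (⊨-as-false σ γ ¬g l) s)

-- Shannon expansion: `l [ γ ]` amounts to (`γ` and `l [ trueᶠ ]`) or (not `γ` and `l [ falseᶠ ]`).
-- Refuting the two disjuncts gives the two bounds on `γ`.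
𝐈-interval : (l : Γ[var] n) → IsInterval (𝐈 l)
𝐈-interval l = ¬ᶠ (l [ trueᶠ ]) , l [ falseᶠ ] ,
  (λ {γ} sh →
    (λ {σ} s t → sh σ (from (⊨-as-true σ γ s l) t)) ,
    (λ {σ} f → decidable-stable (σ ⊨? γ) λ ¬s → sh σ (from (⊨-as-false σ γ ¬s l) f))) ,
  λ {γ} → unsat γ
  where
    unsat : ∀ γ → γ ∈ [ ¬ᶠ (l [ trueᶠ ]) ⋯ l [ falseᶠ ] ] → Shatters γ l
    unsat γ (lo , hi) σ s with σ ⊨? γ
    ... | yes g = lo g (to (⊨-as-true σ γ g l) s)
    ... | no ¬g = ¬g (hi (to (⊨-as-false σ γ ¬g l) s))

⋀𝐈-interval : (S : List (Γ[var] n)) → IsInterval (⋀𝐈 S)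
⋀𝐈-interval []      = trueᶠ , falseᶠ , (λ {γ} _ → full γ) , const []
⋀𝐈-interval (l ∷ S) with g₁ , g₂ , J⊆ , ⊆J ← ∩-interval (𝐈-interval l) (⋀𝐈-interval S) =
  g₁ , g₂ , (λ { (i ∷ is) → J⊆ (i , is) }) , (λ b → proj₁ (⊆J b) ∷ proj₂ (⊆J b))

class : Bool → FmlSet n
class b = if b then [true]∼ε else [false]∼ε

⊨-⟨⊥⟩ : (σ : Stream n) → (σ ⊨ ⟨ ⊥ ⟩) ⇔ (σ ≈ [])
⊨-⟨⊥⟩ σ = mk⇔
  (λ e a → ⇔-sym (≈-letter [] a) ⇔-∘ to (⊨-⟨⟩ σ ⊥) e a)
  (λ σ≈[] → from (⊨-⟨⟩ σ ⊥) λ a → ≈-letter [] a ⇔-∘ σ≈[] a)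

[]⊨⟨⊥⟩ : ∀ n → [] ⊨ ⟨ ⊥ {suc n} ⟩
[]⊨⟨⊥⟩ n = from (⊨-⟨⊥⟩ {n} []) λ _ → ⇔-id _

-- Up to `≈`, `⟨ ⊥ ⟩` has the empty stream as its only model, so `γ` holds there iff `⟨ ⊥ ⟩` entails
-- `γ`.
class-interval : ∀ b → IsInterval {n} (class b)
class-interval {n} true = trueᶠ , ⟨ ⊥ ⟩ ,
  (λ {γ} s → proj₁ (full γ) , λ {σ} e → from (⊨-cong (to (⊨-⟨⊥⟩ σ) e) γ) s) ,
  (λ (_ , hi) → hi {[]} ([]⊨⟨⊥⟩ n))
class-interval {n} false = ¬ᶠ ⟨ ⊥ ⟩ , falseᶠ ,
  (λ {γ} ¬s → (λ {σ} g e → ¬s (to (⊨-cong (to (⊨-⟨⊥⟩ σ) e) γ) g)) , proj₂ (full γ)) ,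
  (λ (lo , _) s → lo {[]} s ([]⊨⟨⊥⟩ n))

class-⊨? : (γ : Γ n) → γ ∈ class (does ([] ⊨? γ))
class-⊨? γ with [] ⊨? γ
... | yes s = s
... | no ¬s = ¬s

class-disjoint : ∀ b {γ : Γ n} → γ ∈ class b → ¬ (γ ∈ class (not b))
class-disjoint true  s ¬s = ¬s s
class-disjoint false ¬s s = ¬s s

-- Runs over unshattered transitions

module Run {n : ℕ} (M : FQA n) (γ : Γ n) where
  open FQA M
  open Shatter M

  _≟_ : DecidableEquality Q
  _≟_ = inj⇒≟ (↔⇒↣ (proj₂ finite))

  -- Accepting runs of fixed length over labels not shattered by `γ`. No word is recorded; the
  -- length index makes existence decidable by recursion.
  LiveRun : Bool → ℕ → Q → Set
  LiveRun b zero    q = q ∈ accepting (constant b)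
  LiveRun b (suc k) q = Any (λ (s , l , t) → s ≡ q × Satisfiable ⟦ l [ γ ] ⟧ × LiveRun b k t) δ

  liveRun? : ∀ b k q → Dec (LiveRun b k q)
  liveRun? b zero    q = [] ⊨? (F q [ constant b ])
  liveRun? b (suc k) q =
    Any.any? (λ (s , l , t) → (s ≟ q) ×-dec satisfiable? (l [ γ ]) ×-dec liveRun? b k t) δ

  module _ {S : List (Γ[var] n)} (S⊆SL : All SL S) (γ∈I : γ ∈ ⋀𝐈 S) where

    -- `δ′` relabels `UL` transitions by `trueᶠ`; they must not be lost when `δ″` discards the
    -- labels in `S`.
    true∉S : trueᶠ ∉ˡ S
    true∉S i with TL-true , ¬UL∪DL ← All.lookup S⊆SL i =
      ¬UL∪DL (inj₁ (TL-true , λ _ sh → sh [] (⊨-true {n} [])))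

    -- An unshattered label is outside `S` and `DL`. It survives as a member of `SL`, or relabelled
    -- if it lies in `UL`; this last alternative is not decided, hence the double negation.
    survives : ∀ {q l q′} → (q , l , q′) ∈ˡ δ → Satisfiable ⟦ l [ γ ] ⟧ → ¬ ¬ (δ″ S (q , trueᶠ , q′))
    survives {q} {l} {q′} e (σ , s) ¬δ″ = ¬δ″ (refl , l , inj₁ (e , TL-l , ¬UL∪DL) , l∉S)
      where
        TL-l : TL l
        TL-l = q , q′ , e
        unshattered : ¬ Shatters γ l
        unshattered sh = sh σ s
        l∉S : l ∉ˡ S
        l∉S i = unshattered (All.lookup γ∈I i)
        ¬UL∪DL : ¬ (UL l ⊎ DL l)
        ¬UL∪DL (inj₁ u)               = ¬δ″ (refl , trueᶠ , inj₂ (refl , l , u , e) , true∉S)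
        ¬UL∪DL (inj₂ (_ , _ , full⊆)) = unshattered (full⊆ (full γ))

    -- All labels of `δ″` are `trueᶠ`, so any word of length `k` will do; empty letters are chosen.
    accepts-of-liveRun : ∀ b k q → LiveRun b k q →
      ¬ ¬ Accepts (approx S (constant b)) q (replicate k ⊥)
    accepts-of-liveRun b zero    q acc ¬a = ¬a (done acc)
    accepts-of-liveRun b (suc k) q run ¬a with _ , e , refl , sat , rest ← find run =
      survives e sat λ d → accepts-of-liveRun b k _ rest λ a → ¬a (step d (⊨-true (⊥ ∷ [])) a)

  trivial? : (l : Γ[var] n) → Dec (𝐈 l ≐ [ trueᶠ ⋯ falseᶠ ])
  trivial? l =
    map′ (λ (t , f) → (λ {γ} _ → full γ) , (λ {γ} _ → shatters-constants l t f γ))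
         (λ (_ , full⊆) → full⊆ (full trueᶠ) , full⊆ (full falseᶠ))
         (unsatisfiable? (l [ trueᶠ ]) ×-dec unsatisfiable? (l [ falseᶠ ]))

  -- Being shattered by `γ` already excludes `UL`, so only `DL` is ruled out explicitly.
  Shattered : Pred (Γ[var] n) 0ℓ
  Shattered l = ¬ (𝐈 l ≐ [ trueᶠ ⋯ falseᶠ ]) × Shatters γ l

  shattered? : Decidable Shattered
  shattered? l = ¬? (trivial? l) ×-dec unsatisfiable? (l [ γ ])

  -- The largest subset of `SL` whose interval contains `γ`, hence the one leaving the fewest
  -- transitions in `δ″`.
  shattered : List (Γ[var] n)
  shattered = filter shattered? (map (proj₁ ∘ proj₂) δ)

  shattered⊆SL : All SL shattered
  shattered⊆SL = All.tabulate λ {l} i →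
    let l∈ , ¬trivial , sh = ∈-filter⁻ shattered? {xs = map (proj₁ ∘ proj₂) δ} i
        (q , _ , q′) , e , l≡ = ∈-map⁻ (proj₁ ∘ proj₂) l∈
    in (q , q′ , subst (λ l → (q , l , q′) ∈ˡ δ) (sym l≡) e) ,
       λ { (inj₁ (_ , empty)) → empty γ sh ; (inj₂ (_ , trivial)) → ¬trivial trivial }

  γ∈⋀shattered : γ ∈ ⋀𝐈 shattered
  γ∈⋀shattered = All.tabulate λ i →
    proj₂ (proj₂ (∈-filter⁻ shattered? {xs = map (proj₁ ∘ proj₂) δ} i))

  unshattered-of-δ″ : ∀ {q g q′} → δ″ shattered (q , g , q′) →
    ∃[ l ] ((q , l , q′) ∈ˡ δ) × Satisfiable ⟦ l [ γ ] ⟧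
  unshattered-of-δ″ (_ , l , inj₁ (e , TL-l , ¬UL∪DL) , l∉) =
    l , e , decidable-stable (satisfiable? (l [ γ ])) λ ¬sat →
      l∉ (∈-filter⁺ shattered? (∈-map⁺ (proj₁ ∘ proj₂) e)
           ((λ trivial → ¬UL∪DL (inj₂ (TL-l , trivial))) , λ σ s → ¬sat (σ , s)))
  unshattered-of-δ″ (_ , _ , inj₂ (_ , l , (_ , empty) , e) , _) =
    l , e , decidable-stable (satisfiable? (l [ γ ])) λ ¬sat → empty γ λ σ s → ¬sat (σ , s)

  liveRun-of-accepts : ∀ b {q w} → Accepts (approx shattered (constant b)) q w → LiveRun b (length w) q
  liveRun-of-accepts b (done acc)   = acc
  liveRun-of-accepts b (step d _ a) with _ , e , sat ← unshattered-of-δ″ d =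
    lose e (refl , sat , liveRun-of-accepts b a)

-- The intervals collected by the procedure

module Collected {n : ℕ} (M : FQA n) where
  open FQA M
  open Shatter M

  part : List (Γ[var] n) → Bool → FmlSet n
  part S b = ⋀𝐈 S ∩ class b

  Condition : List (Γ[var] n) → Bool → Set
  Condition S b = Satisfiable (part S b) × Empty (L (approx S (constant b)))

  PSC⇔ : ∀ {S J} → PSC S J ⇔ (∃[ b ] Condition S b × J ≐ part S b)
  PSC⇔ = mk⇔
    (λ { (add-true s e j) → true , (s , e) , j ; (add-false s e j) → false , (s , e) , j })
    (λ { (true , (s , e) , j) → add-true s e j ; (false , (s , e) , j) → add-false s e j })

  -- Up to `≐` each Boolean contributes at most one element, so two distinct elements come from
  -- different Booleans.
  both-conditions : ∀ {S} → HasTwoElements (PSC S) → ∀ b → Condition S b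
  both-conditions (J , K , J∈ , K∈ , J≢K , _) b with to PSC⇔ J∈ | to PSC⇔ K∈
  ... | true  , _ , j | true  , _ , k = contradiction (≐-trans j (≐-sym k)) J≢K
  ... | false , _ , j | false , _ , k = contradiction (≐-trans j (≐-sym k)) J≢K
  both-conditions _ true  | true  , c , _ | false , _ , _ = c
  both-conditions _ false | true  , _ , _ | false , c , _ = c
  both-conditions _ true  | false , _ , _ | true  , c , _ = c
  both-conditions _ false | false , c , _ | true  , _ , _ = c

  two-elements : ∀ {S} b → Condition S b → Condition S (not b) → HasTwoElements (PSC S)
  two-elements {S} b c@((γ , γ∈) , _) c′ =
    part S b , part S (not b) ,
    from PSC⇔ (b , c , ≐-refl) , from PSC⇔ (not b , c′ , ≐-refl) ,
    -- Inhabitedness separates the parts: a formula of the first would lie in both classes.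
    (λ (⊆ , _) → class-disjoint b (proj₂ γ∈) (proj₂ (⊆ γ∈))) ,
    λ H H∈ → split b (to PSC⇔ H∈)
    where
      split : ∀ b {H} → (∃[ b′ ] Condition S b′ × H ≐ part S b′) → (H ≐ part S b) ⊎ (H ≐ part S (not b))
      split true  (true  , _ , h) = inj₁ h
      split true  (false , _ , h) = inj₂ h
      split false (true  , _ , h) = inj₂ h
      split false (false , _ , h) = inj₁ h

  SC-sound : ∀ {J γ} → J ∈ SC → γ ∈ J →
    ∃[ S ] All SL S × γ ∈ ⋀𝐈 S × Empty (L (approx S (constant (does ([] ⊨? γ)))))
  SC-sound {γ = γ} (add-whole S S⊆ two (J⊆ , _)) γ∈J =
    S , S⊆ , J⊆ γ∈J , proj₂ (both-conditions two (does ([] ⊨? γ)))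
  SC-sound {γ = γ} (add-parts S S⊆ _ J∈) γ∈J with to PSC⇔ J∈ | [] ⊨? γ
  ... | true  , (_ , e) , J⊆ , _ | yes _ = S , S⊆ , proj₁ (J⊆ γ∈J) , e
  ... | false , (_ , e) , J⊆ , _ | no  _ = S , S⊆ , proj₁ (J⊆ γ∈J) , e
  ... | true  , _ , J⊆ , _ | no ¬s = contradiction (proj₂ (J⊆ γ∈J)) ¬s
  ... | false , _ , J⊆ , _ | yes s = contradiction s (proj₂ (J⊆ γ∈J))

  -- The test for the class of `γ` succeeds; deciding the opposite one tells whether the whole
  -- interval or only the part is collected.
  SC-complete : ∀ {γ} S → All SL S → γ ∈ ⋀𝐈 S → (∀ b → Dec (Empty (L (approx S (constant b))))) →
    Empty (L (approx S (constant (does ([] ⊨? γ))))) →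
    ∃₂ λ γ₁ γ₂ → [ γ₁ ⋯ γ₂ ] ∈ SC × γ₁ ≤ᶠ γ × γ ≤ᶠ γ₂
  SC-complete {γ} S S⊆ γ∈I empty? empty =
    choose (interval-satisfiable? (part-interval (not b)) ×-dec empty? (not b))
    where
      b : Bool
      b = does ([] ⊨? γ)
      part-interval : ∀ b → IsInterval (part S b)
      part-interval b = ∩-interval (⋀𝐈-interval S) (class-interval b)
      γ∈part : γ ∈ part S b
      γ∈part = γ∈I , class-⊨? γ
      condition : Condition S b
      condition = (γ , γ∈part) , empty
      choose : Dec (Condition S (not b)) → ∃₂ λ γ₁ γ₂ → [ γ₁ ⋯ γ₂ ] ∈ SC × γ₁ ≤ᶠ γ × γ ≤ᶠ γ₂
      choose (yes c′) = let γ₁ , γ₂ , I = ⋀𝐈-interval S in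
        γ₁ , γ₂ , add-whole S S⊆ (two-elements b condition c′) (≐-sym I) , proj₁ I γ∈I
      choose (no ¬c′) = let γ₁ , γ₂ , I = part-interval b in
        γ₁ , γ₂ ,
        add-parts S S⊆ (λ two → ¬c′ (both-conditions two (not b))) (from PSC⇔ (b , condition , ≐-sym I)) ,
        proj₁ I γ∈part

-- Runs of the composition

drop-inject₁ : ∀ {A : Set} (xs : List A) (i : Fin (length xs)) →
  drop (toℕ (inject₁ i)) xs ≡ lookup xs i ∷ drop (suc (toℕ i)) xs
drop-inject₁ (x ∷ xs) zero    = refl
drop-inject₁ (x ∷ xs) (suc i) = drop-inject₁ xs i

drop-fromℕ : ∀ {A : Set} (xs : List A) → drop (toℕ (fromℕ (length xs))) xs ≡ []
drop-fromℕ xs = drop-all _ xs (≤-reflexive (sym (toℕ-fromℕ (length xs))))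

module Composite {n : ℕ} (π : Stream n) (M₂ : FQA n) (γ : Γ n) where
  private module M₂ = FQA M₂

  Mᶜ : FQA n
  Mᶜ = compose (pathPNFA π) (pathPNFA-effective π) M₂

  open Run Mᶜ γ public using (LiveRun)

  edge : Fin (suc (length π)) × Γ n × Fin (suc (length π)) → M₂.Q × Γ[var] n × M₂.Q →
         FQA.Q Mᶜ × Γ[var] n × FQA.Q Mᶜ
  edge (q₁ , γ₁ , q₁′) (q₂ , γ₂ , q₂′) = (q₁ , q₂) , (embed γ₁ ∧ᶠ γ₂) , (q₁′ , q₂′)

  -- An inductive view of the composed transitions, so that matching exposes the path position and
  -- the underlying transition of `M₂`.
  data Edge : FQA.Q Mᶜ × Γ[var] n × FQA.Q Mᶜ → Set where
    mkEdge : ∀ i {q l q′} → (q , l , q′) ∈ˡ M₂.δ →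
             Edge ((inject₁ i , q) , (embed ⟨ lookup π i ⟩ ∧ᶠ l) , (suc i , q′))

  edge-view : ∀ {e} → e ∈ˡ FQA.δ Mᶜ → Edge e
  edge-view e∈
    with _ , _ , t∈ , e₂∈ , refl ← ∈-cartesianProductWith⁻ edge (pathTransitions π) M₂.δ e∈
    with i , _ , refl ← ∈-map⁻ _ t∈ = mkEdge i e₂∈

  edge-member : ∀ {e} → Edge e → e ∈ˡ FQA.δ Mᶜ
  edge-member (mkEdge i e₂∈) = ∈-cartesianProductWith⁺ edge (∈-map⁺ _ (∈-allFin i)) e₂∈

  rest : Fin (suc (length π)) → Stream n
  rest i = drop (toℕ i) π

  accepting-final : ∀ b i q → (i , q) ∈ FQA.accepting Mᶜ (constant b) →
    i ≡ fromℕ (length π) × q ∈ M₂.accepting (constant b)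
  accepting-final b i q acc with i ≟ᶠ fromℕ (length π)
  ... | yes i≡ = i≡ , acc
  ... | no  _  = contradiction (⊨-true {n} []) acc

  final-accepting : ∀ {b q} → q ∈ M₂.accepting (constant b) →
    (fromℕ (length π) , q) ∈ FQA.accepting Mᶜ (constant b)
  final-accepting acc
    rewrite dec-true (fromℕ (length π) ≟ᶠ fromℕ (length π)) refl = acc

  -- Each edge advances one position along the path, and acceptance occurs only at its end.
  liveRun-length : ∀ b k {i q} → LiveRun b k (i , q) → k ≡ length (rest i)
  liveRun-length b zero {i} {q} acc with refl , _ ← accepting-final b i q acc =
    sym (cong length (drop-fromℕ π))
  liveRun-length b (suc k) run with _ , e , refl , _ , r ← find run with mkEdge i _ ← edge-view e =
    trans (cong suc (liveRun-length b k r)) (sym (cong length (drop-inject₁ π i)))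

  -- Acceptance conditions are evaluated at the empty stream, where `γ` acts as this constant.
  constantε : Bool
  constantε = does ([] ⊨? γ)

  accepts-of-liveRun₂ : ∀ k {i q} → LiveRun constantε k (i , q) → Accepts (instantiate M₂ γ) q (rest i)
  accepts-of-liveRun₂ zero {i} {q} acc
    with refl , acc₂ ← accepting-final constantε i q acc rewrite drop-fromℕ π =
    done (from (⊨-[]-cong [] (⊨-constant [] γ) (M₂.F q)) acc₂)
  accepts-of-liveRun₂ (suc k) run with _ , e , refl , sat , r ← find run
    with mkEdge i {l = l} e₂ ← edge-view e | σ , σ⊨A , σ⊨l ← sat rewrite drop-inject₁ π i =
    step (l , e₂ , refl)
      -- The witness `σ` satisfies `⟨ lookup π i ⟩`, so it agrees with that letter on all atoms and
      -- the truth of `l [ γ ]` transfers to it.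
      (to (⊨-cong (to (⊨-⟨⟩ σ (lookup π i)) (to (⊨-embed-[] σ ⟨ lookup π i ⟩ γ) σ⊨A)) (l [ γ ])) σ⊨l)
      (accepts-of-liveRun₂ k r)

  -- The word is a variable with an equation because `rest i` is no constructor form on which the
  -- acceptance derivation could be matched.
  liveRun-of-accepts₂ : ∀ {i q w} → w ≡ rest i → Accepts (instantiate M₂ γ) q w →
    LiveRun constantε (length w) (i , q)
  liveRun-of-accepts₂ {i} w≡ a with view i
  liveRun-of-accepts₂ {q = q} w≡ a | ‵fromℕ with trans w≡ (drop-fromℕ π)
  liveRun-of-accepts₂ {q = q} w≡ (done acc) | ‵fromℕ | refl =
    final-accepting {constantε} (to (⊨-[]-cong [] (⊨-constant [] γ) (M₂.F q)) acc)
  liveRun-of-accepts₂ w≡ a | ‵inject₁ i with trans w≡ (drop-inject₁ π i)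
  liveRun-of-accepts₂ w≡ (step (l , e₂ , refl) A⊨l a) | ‵inject₁ i | refl =
    lose (edge-member (mkEdge i e₂))
      (refl ,
       (lookup π i ∷ [] ,
        from (⊨-embed-[] _ ⟨ lookup π i ⟩ γ) (from (⊨-⟨⟩ _ (lookup π i)) (λ _ → ⇔-id _)) ,
        A⊨l) ,
       liveRun-of-accepts₂ {suc i} refl a)

-- Correctness of query checking.

theorem9 : (n : ℕ) (π : Stream n) (φ : Query n) (M¬φ : FQAFor (¬ᶠ φ)) (γ : Γ n) →
    (π ⊨ φ [ γ ]) ⇔
    (∃₂ λ (γ₁ γ₂ : Γ n) → [ γ₁ ⋯ γ₂ ] ∈ QC1 π φ M¬φ × γ₁ ≤ᶠ γ × γ ≤ᶠ γ₂)
theorem9 n π φ M¬φ γ = mk⇔ complete sound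
  where
    open FQAFor M¬φ renaming (automaton to M₂)
    open Composite π M₂ γ
    open Run Mᶜ γ hiding (LiveRun)
    open Collected Mᶜ
    open Shatter Mᶜ

    qI : FQA.Q Mᶜ
    qI = FQA.qI Mᶜ

    empty-of-no-run : ∀ b → ¬ LiveRun b (length π) qI → Empty (L (approx shattered (constant b)))
    empty-of-no-run b ¬run w a =
      ¬run (subst (λ k → LiveRun b k qI) (liveRun-length b (length w) r) r)
      where r = liveRun-of-accepts b a

    -- Only the length of `π` is possible for a live run, so emptiness over all words reduces to one
    -- bounded search.
    empty? : ∀ b → Dec (Empty (L (approx shattered (constant b))))
    empty? b = map′ (empty-of-no-run b)
      (λ empty r → accepts-of-liveRun shattered⊆SL γ∈⋀shattered b (length π) qI r (empty _))
      (¬? (liveRun? b (length π) qI))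

    complete : π ⊨ φ [ γ ] → ∃₂ λ γ₁ γ₂ → [ γ₁ ⋯ γ₂ ] ∈ QC1 π φ M¬φ × γ₁ ≤ᶠ γ × γ ≤ᶠ γ₂
    complete π⊨ = SC-complete shattered shattered⊆SL γ∈⋀shattered empty?
      (empty-of-no-run constantε λ r → proj₁ (correct γ) (accepts-of-liveRun₂ (length π) r) π⊨)

    sound : (∃₂ λ γ₁ γ₂ → [ γ₁ ⋯ γ₂ ] ∈ QC1 π φ M¬φ × γ₁ ≤ᶠ γ × γ ≤ᶠ γ₂) → π ⊨ φ [ γ ]
    -- This `S` need not be `shattered`: unshattered transitions survive for every `S` whose
    -- interval contains `γ`.
    sound (γ₁ , γ₂ , J∈ , γ∈) with S , S⊆ , γ∈I , empty ← SC-sound J∈ γ∈ =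
      decidable-stable (π ⊨? (φ [ γ ])) λ π⊭ →
        accepts-of-liveRun S⊆ γ∈I constantε (length π) qI
          (liveRun-of-accepts₂ {PNFA.qI (pathPNFA π)} refl (proj₂ (correct γ) π⊭)) (empty _)
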